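{- Let $\mathcal D_1=(L_1,\|\cdot\|_1)$ and $\mathcal D_2=(L_2,\|\cdot\|_2)$ be arithmetic divisors on $\overline{\operatorname{Spec}\mathbf{Z}}$ that are non-degenerate, i.e. whose semi-norms are not identically zero. For $\mathcal D=(L,\|\cdot\|)$ let $S(\mathcal D)=\{\|x\|\mid x\in L\}\subset[0,\infty)$. Then $\mathcal D_1$ and $\mathcal D_2$ are isomorphic if and only if $S(\mathcal D_1)=S(\mathcal D_2)$.
   Context: An arithmetic divisor on $\overline{\operatorname{Spec}\mathbf{Z}}$ is a pair $(L,\|\cdot\|)$ with $L$ torsion-free abelian of rank 1 and $\|\cdot\|$ a semi-norm on $L\otimes_\mathbf{Z}\mathbf{R}$ of the form $\lambda|\phi(\cdot)|$ with $\phi:L\otimes\mathbf{R}\to\mathbf{R}$ an isomorphism and $\lambda\ge0$. An isomorphism $(L_1,\|\cdot\|_1)\to(L_2,\|\cdot\|_2)$ is a group isomorphism $\psi:L_1\to L_2$ with $\|\psi(x)\|_2=\|x\|_1$ for all $x\in L_1$. -}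

module Defs where

open import Algebra.Bundles using (AbelianGroup; CommutativeRing)
import Algebra.Definitions.RawMonoid as RawMonoidDefinitions
open import Algebra.Module.Bundles using (Module)
import Algebra.Module.Construct.TensorUnit as TensorUnit
open import Algebra.Module.Morphism.Structures using (module ModuleMorphisms)
open import Algebra.Module.Structures.Biased using (module IsModuleFromLeft)
open import Algebra.Morphism.Structures using (module GroupMorphisms)
open import Data.Integer.Base using (ℤ; +_; -[1+_]; 0ℤ)
open import Data.Nat.Base as ℕ using (ℕ; suc)
import Data.Nat.Properties as ℕₚ
open import Data.Product using (Σ-syntax; ∃-syntax; _×_; _,_; proj₁; proj₂)
open import Data.Rational.Base as ℚ using (ℚ; 0ℚ; 1ℚ; ½; Positive; positive)
import Data.Rational.Properties as ℚₚ
open import Data.Rational.Solver using (module +-*-Solver)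
open import Data.Sum.Base using (inj₁; inj₂)
open import Data.Vec.Functional using (Vector; _∷_)
open import Level using (Level; 0ℓ; _⊔_) renaming (suc to lsuc)
open import Relation.Binary.PropositionalEquality
  using (_≡_; _≢_; refl; sym; trans; cong; cong₂; subst)
open import Relation.Nullary.Negation using (¬_)
open import Relation.Unary using (Pred)

-- ℝ is the setoid of Cauchy sequences of rationals, two sequences being
-- equal when their difference tends to 0.

Null : (ℕ → ℚ) → Set
Null s = ∀ ε → 0ℚ ℚ.< ε → ∃[ N ] (∀ n → N ℕ.≤ n → ℚ.∣ s n ∣ ℚ.≤ ε)

Cauchy : (ℕ → ℚ) → Set
Cauchy s = ∀ ε → 0ℚ ℚ.< ε →
  ∃[ N ] (∀ m n → N ℕ.≤ m → N ℕ.≤ n → ℚ.∣ s m ℚ.- s n ∣ ℚ.≤ ε)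

record ℝ : Set where
  no-eta-equality
  constructor mkℝ
  field
    seq      : ℕ → ℚ
    isCauchy : Cauchy seq

open ℝ public

infix 4 _≈ℝ_ _≤ℝ_

record _≈ℝ_ (x y : ℝ) : Set where
  constructor mk≈ℝ
  field
    difference-null : Null (λ n → seq x n ℚ.- seq y n)

open _≈ℝ_ public

record _≤ℝ_ (x y : ℝ) : Set where
  constructor mk≤ℝ
  field
    eventually-≤ : ∀ ε → 0ℚ ℚ.< ε →
      ∃[ N ] (∀ n → N ℕ.≤ n → seq x n ℚ.≤ seq y n ℚ.+ ε)

open _≤ℝ_ public

open +-*-Solver

cancel-middle : ∀ p q → q ℚ.+ (p ℚ.- q) ≡ p
cancel-middle = solve 2 (λ x y → y :+ (x :- y) := x) refl

cancel-left : ∀ q r → (q ℚ.+ r) ℚ.- q ≡ r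
cancel-left = solve 2 (λ x y → (x :+ y) :- x := y) refl

neg-difference : ∀ p q → ℚ.- (p ℚ.- q) ≡ q ℚ.- p
neg-difference = solve 2 (λ x y → :- (x :- y) := y :- x) refl

difference-neg : ∀ p q → q ℚ.- p ≡ (ℚ.- p) ℚ.- (ℚ.- q)
difference-neg = solve 2 (λ x y → y :- x := (:- x) :- (:- y)) refl

difference-trans : ∀ p q r → (p ℚ.- q) ℚ.+ (q ℚ.- r) ≡ p ℚ.- r
difference-trans = solve 3 (λ x y z → (x :- y) :+ (y :- z) := x :- z) refl

difference-+ : ∀ a b c d → (a ℚ.- b) ℚ.+ (c ℚ.- d) ≡ (a ℚ.+ c) ℚ.- (b ℚ.+ d)
difference-+ = solve 4 (λ a b c d → (a :- b) :+ (c :- d) := (a :+ c) :- (b :+ d)) refl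

difference-* : ∀ a b c d →
  a ℚ.* (c ℚ.- d) ℚ.+ d ℚ.* (a ℚ.- b) ≡ a ℚ.* c ℚ.- b ℚ.* d
difference-* =
  solve 4 (λ a b c d → a :* (c :- d) :+ d :* (a :- b) := a :* c :- b :* d) refl

EventuallyBoundedBy : ℚ → (ℕ → ℚ) → Set
EventuallyBoundedBy B s = ∃[ N ] (∀ n → N ℕ.≤ n → ℚ.∣ s n ∣ ℚ.≤ B)

half-pos : ∀ ε → 0ℚ ℚ.< ε → 0ℚ ℚ.< ½ ℚ.* ε
half-pos ε 0<ε = ℚₚ.positive⁻¹ _ {{ℚₚ.pos*pos⇒pos ½ ε {{positive 0<ε}}}}

halves : ∀ ε → ½ ℚ.* ε ℚ.+ ½ ℚ.* ε ≡ ε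
halves ε = trans (sym (ℚₚ.*-distribʳ-+ ε ½ ½)) (ℚₚ.*-identityˡ ε)

∣+∣-≤ : ∀ p q {a b} → ℚ.∣ p ∣ ℚ.≤ a → ℚ.∣ q ∣ ℚ.≤ b → ℚ.∣ p ℚ.+ q ∣ ℚ.≤ a ℚ.+ b
∣+∣-≤ p q p≤a q≤b = ℚₚ.≤-trans (ℚₚ.∣p+q∣≤∣p∣+∣q∣ p q) (ℚₚ.+-mono-≤ p≤a q≤b)

∣*∣-≤ : ∀ p q {a b} → 0ℚ ℚ.< a → ℚ.∣ p ∣ ℚ.≤ a → ℚ.∣ q ∣ ℚ.≤ b →
        ℚ.∣ p ℚ.* q ∣ ℚ.≤ a ℚ.* b
∣*∣-≤ p q {a} {b} 0<a p≤a q≤b =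
  subst (ℚ._≤ a ℚ.* b) (sym (ℚₚ.∣p*q∣≡∣p∣*∣q∣ p q))
    (ℚₚ.≤-trans
      (ℚₚ.*-monoʳ-≤-nonNeg ℚ.∣ q ∣ {{ℚₚ.∣-∣-nonNeg q}} p≤a)
      (ℚₚ.*-monoˡ-≤-nonNeg a {{ℚₚ.pos⇒nonNeg a {{positive 0<a}}}} q≤b))

≤-by-difference : ∀ p q → ℚ.∣ p ∣ ℚ.≤ ℚ.∣ q ∣ ℚ.+ ℚ.∣ p ℚ.- q ∣
≤-by-difference p q =
  subst (λ r → ℚ.∣ r ∣ ℚ.≤ ℚ.∣ q ∣ ℚ.+ ℚ.∣ p ℚ.- q ∣)
    (cancel-middle p q)
    (ℚₚ.∣p+q∣≤∣p∣+∣q∣ q (p ℚ.- q))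

∣-∣-swap : ∀ p q → ℚ.∣ p ℚ.- q ∣ ≡ ℚ.∣ q ℚ.- p ∣
∣-∣-swap p q = trans
  (cong ℚ.∣_∣ (sym (neg-difference q p)))
  (ℚₚ.∣-p∣≡∣p∣ (q ℚ.- p))

-≤-from-≤+ : ∀ p q r → p ℚ.≤ q ℚ.+ r → p ℚ.- q ℚ.≤ r
-≤-from-≤+ p q r p≤q+r =
  subst (p ℚ.- q ℚ.≤_)
    (cancel-left q r)
    (ℚₚ.+-monoˡ-≤ (ℚ.- q) p≤q+r)

reverse-triangle : ∀ p q → ℚ.∣ ℚ.∣ p ∣ ℚ.- ℚ.∣ q ∣ ∣ ℚ.≤ ℚ.∣ p ℚ.- q ∣
reverse-triangle p q with ℚₚ.∣p∣≡p∨∣p∣≡-p (ℚ.∣ p ∣ ℚ.- ℚ.∣ q ∣)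
... | inj₁ eq = subst (ℚ._≤ ℚ.∣ p ℚ.- q ∣) (sym eq)
        (-≤-from-≤+ ℚ.∣ p ∣ ℚ.∣ q ∣ ℚ.∣ p ℚ.- q ∣ (≤-by-difference p q))
... | inj₂ eq = subst (ℚ._≤ ℚ.∣ p ℚ.- q ∣)
        (sym (trans eq (neg-difference ℚ.∣ p ∣ ℚ.∣ q ∣)))
        (-≤-from-≤+ ℚ.∣ q ∣ ℚ.∣ p ∣ ℚ.∣ p ℚ.- q ∣
          (subst (λ r → ℚ.∣ q ∣ ℚ.≤ ℚ.∣ p ∣ ℚ.+ r) (∣-∣-swap q p)
            (≤-by-difference q p)))

∣difference-*∣-≤ : ∀ a b c d {A B δ} → 0ℚ ℚ.< A → 0ℚ ℚ.< B →
  ℚ.∣ a ∣ ℚ.≤ A → ℚ.∣ d ∣ ℚ.≤ B → ℚ.∣ a ℚ.- b ∣ ℚ.≤ δ → ℚ.∣ c ℚ.- d ∣ ℚ.≤ δ →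
  ℚ.∣ a ℚ.* c ℚ.- b ℚ.* d ∣ ℚ.≤ (A ℚ.+ B) ℚ.* δ
∣difference-*∣-≤ a b c d {A} {B} {δ} 0<A 0<B a≤A d≤B ab cd =
  subst (ℚ.∣ a ℚ.* c ℚ.- b ℚ.* d ∣ ℚ.≤_) (sym (ℚₚ.*-distribʳ-+ δ A B))
    (subst (λ r → ℚ.∣ r ∣ ℚ.≤ A ℚ.* δ ℚ.+ B ℚ.* δ) (difference-* a b c d)
      (∣+∣-≤ (a ℚ.* (c ℚ.- d)) (d ℚ.* (a ℚ.- b))
        (∣*∣-≤ a (c ℚ.- d) 0<A a≤A cd)
        (∣*∣-≤ d (a ℚ.- b) 0<B d≤B ab)))

null-cong : ∀ {s t} → (∀ n → s n ≡ t n) → Null s → Null t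
null-cong s≡t s-null ε 0<ε with s-null ε 0<ε
... | N , small = N , λ n N≤n → subst (λ r → ℚ.∣ r ∣ ℚ.≤ ε) (s≡t n) (small n N≤n)

null-0 : ∀ {s} → (∀ n → s n ≡ 0ℚ) → Null s
null-0 s≡0 ε 0<ε =
  0 , λ n _ → subst (λ r → ℚ.∣ r ∣ ℚ.≤ ε) (sym (s≡0 n)) (ℚₚ.<⇒≤ 0<ε)

null-neg : ∀ {s} → Null s → Null (λ n → ℚ.- s n)
null-neg {s} s-null ε 0<ε with s-null ε 0<ε
... | N , small =
  N , λ n N≤n → subst (ℚ._≤ ε) (sym (ℚₚ.∣-p∣≡∣p∣ (s n))) (small n N≤n)

null-+ : ∀ {s t} → Null s → Null t → Null (λ n → s n ℚ.+ t n)
null-+ {s} {t} s-null t-null ε 0<ε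
  with s-null (½ ℚ.* ε) (half-pos ε 0<ε) | t-null (½ ℚ.* ε) (half-pos ε 0<ε)
... | M , s-small | N , t-small =
  M ℕ.⊔ N , λ n le → subst (ℚ.∣ s n ℚ.+ t n ∣ ℚ.≤_) (halves ε)
    (∣+∣-≤ (s n) (t n) (s-small n (ℕₚ.m⊔n≤o⇒m≤o M N le))
                       (t-small n (ℕₚ.m⊔n≤o⇒n≤o M N le)))

scale-down : ∀ c ε → 0ℚ ℚ.< c → 0ℚ ℚ.< ε → Σ[ δ ∈ ℚ ] (0ℚ ℚ.< δ × c ℚ.* δ ≡ ε)
scale-down c ε 0<c 0<ε = δ , 0<δ , c*δ≡ε
  where
  instance
    c-pos : Positive c
    c-pos = positive 0<c
    c-nonZero : ℚ.NonZero c
    c-nonZero = ℚₚ.pos⇒nonZero c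
  δ : ℚ
  δ = ℚ.1/ c ℚ.* ε
  0<δ : 0ℚ ℚ.< δ
  0<δ = ℚₚ.positive⁻¹ δ
    {{ℚₚ.pos*pos⇒pos (ℚ.1/ c) {{ℚₚ.1/pos⇒pos c}} ε {{positive 0<ε}}}}
  c*δ≡ε : c ℚ.* δ ≡ ε
  c*δ≡ε = trans (sym (ℚₚ.*-assoc c (ℚ.1/ c) ε))
    (trans (cong (ℚ._* ε) (ℚₚ.*-inverseʳ c)) (ℚₚ.*-identityˡ ε))

null-* : ∀ {s t B} → 0ℚ ℚ.< B → EventuallyBoundedBy B s → Null t →
         Null (λ n → s n ℚ.* t n)
null-* {s} {t} {B} 0<B (M , s-bounded) t-null ε 0<ε
  with scale-down B ε 0<B 0<ε
... | δ , 0<δ , B*δ≡ε with t-null δ 0<δ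
... | N , t-small =
  M ℕ.⊔ N , λ n le → subst (ℚ.∣ s n ℚ.* t n ∣ ℚ.≤_) B*δ≡ε
    (∣*∣-≤ (s n) (t n) 0<B (s-bounded n (ℕₚ.m⊔n≤o⇒m≤o M N le))
                           (t-small n (ℕₚ.m⊔n≤o⇒n≤o M N le)))

bounded : ∀ s → Cauchy s → Σ[ B ∈ ℚ ] (0ℚ ℚ.< B × EventuallyBoundedBy B s)
bounded s s-cauchy with s-cauchy 1ℚ (ℚₚ.positive⁻¹ 1ℚ)
... | N , close =
  ℚ.∣ s N ∣ ℚ.+ 1ℚ ,
  ℚₚ.+-mono-≤-< (ℚₚ.0≤∣p∣ (s N)) (ℚₚ.positive⁻¹ 1ℚ) ,
  N , λ n N≤n → ℚₚ.≤-trans (≤-by-difference (s n) (s N))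
    (ℚₚ.+-monoʳ-≤ ℚ.∣ s N ∣ (close n N N≤n ℕₚ.≤-refl))

≈-pointwise : ∀ {x y} → (∀ n → seq x n ≡ seq y n) → x ≈ℝ y
≈-pointwise {x} {y} eq = mk≈ℝ (null-0 λ n →
  trans (cong (ℚ._- seq y n) (eq n)) (ℚₚ.+-inverseʳ (seq y n)))

cauchy-const : ∀ q → Cauchy (λ _ → q)
cauchy-const q ε 0<ε =
  0 , λ _ _ _ _ → subst (λ r → ℚ.∣ r ∣ ℚ.≤ ε) (sym (ℚₚ.+-inverseʳ q)) (ℚₚ.<⇒≤ 0<ε)

cauchy-+ : ∀ {s t} → Cauchy s → Cauchy t → Cauchy (λ n → s n ℚ.+ t n)
cauchy-+ {s} {t} s-cauchy t-cauchy ε 0<ε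
  with s-cauchy (½ ℚ.* ε) (half-pos ε 0<ε) | t-cauchy (½ ℚ.* ε) (half-pos ε 0<ε)
... | M , s-close | N , t-close = M ℕ.⊔ N , λ m n Lm Ln →
  subst (λ r → ℚ.∣ r ∣ ℚ.≤ ε) (difference-+ (s m) (s n) (t m) (t n))
    (subst (ℚ.∣ (s m ℚ.- s n) ℚ.+ (t m ℚ.- t n) ∣ ℚ.≤_) (halves ε)
      (∣+∣-≤ (s m ℚ.- s n) (t m ℚ.- t n)
        (s-close m n (ℕₚ.m⊔n≤o⇒m≤o M N Lm) (ℕₚ.m⊔n≤o⇒m≤o M N Ln))
        (t-close m n (ℕₚ.m⊔n≤o⇒n≤o M N Lm) (ℕₚ.m⊔n≤o⇒n≤o M N Ln))))

cauchy-neg : ∀ {s} → Cauchy s → Cauchy (λ n → ℚ.- s n)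
cauchy-neg {s} s-cauchy ε 0<ε with s-cauchy ε 0<ε
... | N , close = N , λ m n Nm Nn →
  subst (λ r → ℚ.∣ r ∣ ℚ.≤ ε) (difference-neg (s m) (s n)) (close n m Nn Nm)

cauchy-* : ∀ {s t A B} → 0ℚ ℚ.< A → 0ℚ ℚ.< B →
  EventuallyBoundedBy A s → EventuallyBoundedBy B t →
  Cauchy s → Cauchy t → Cauchy (λ n → s n ℚ.* t n)
cauchy-* {s} {t} {A} {B} 0<A 0<B (Nₛ , s-bounded) (Nₜ , t-bounded) s-cauchy t-cauchy ε 0<ε =
  finish (scale-down (A ℚ.+ B) ε (ℚₚ.+-mono-< 0<A 0<B) 0<ε)
  where
  Goal : Set
  Goal = ∃[ K ] (∀ m n → K ℕ.≤ m → K ℕ.≤ n →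
           ℚ.∣ s m ℚ.* t m ℚ.- s n ℚ.* t n ∣ ℚ.≤ ε)

  combine : ∀ δ → (A ℚ.+ B) ℚ.* δ ≡ ε →
    ∃[ M ] (∀ m n → M ℕ.≤ m → M ℕ.≤ n → ℚ.∣ s m ℚ.- s n ∣ ℚ.≤ δ) →
    ∃[ N ] (∀ m n → N ℕ.≤ m → N ℕ.≤ n → ℚ.∣ t m ℚ.- t n ∣ ℚ.≤ δ) → Goal
  combine δ eq (M , s-close) (N , t-close) =
    (Nₛ ℕ.⊔ Nₜ) ℕ.⊔ (M ℕ.⊔ N) , λ m n Km Kn →
      subst (ℚ.∣ s m ℚ.* t m ℚ.- s n ℚ.* t n ∣ ℚ.≤_) eq
        (∣difference-*∣-≤ (s m) (s n) (t m) (t n) 0<A 0<B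
          (s-bounded m (ℕₚ.m⊔n≤o⇒m≤o Nₛ Nₜ (left Km)))
          (t-bounded n (ℕₚ.m⊔n≤o⇒n≤o Nₛ Nₜ (left Kn)))
          (s-close m n (ℕₚ.m⊔n≤o⇒m≤o M N (right Km)) (ℕₚ.m⊔n≤o⇒m≤o M N (right Kn)))
          (t-close m n (ℕₚ.m⊔n≤o⇒n≤o M N (right Km)) (ℕₚ.m⊔n≤o⇒n≤o M N (right Kn))))
    where
    left : ∀ {k} → (Nₛ ℕ.⊔ Nₜ) ℕ.⊔ (M ℕ.⊔ N) ℕ.≤ k → Nₛ ℕ.⊔ Nₜ ℕ.≤ k
    left = ℕₚ.m⊔n≤o⇒m≤o (Nₛ ℕ.⊔ Nₜ) (M ℕ.⊔ N)
    right : ∀ {k} → (Nₛ ℕ.⊔ Nₜ) ℕ.⊔ (M ℕ.⊔ N) ℕ.≤ k → M ℕ.⊔ N ℕ.≤ k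
    right = ℕₚ.m⊔n≤o⇒n≤o (Nₛ ℕ.⊔ Nₜ) (M ℕ.⊔ N)

  finish : Σ[ δ ∈ ℚ ] (0ℚ ℚ.< δ × (A ℚ.+ B) ℚ.* δ ≡ ε) → Goal
  finish (δ , 0<δ , eq) = combine δ eq (s-cauchy δ 0<δ) (t-cauchy δ 0<δ)

cauchy-∣∣ : ∀ {s} → Cauchy s → Cauchy (λ n → ℚ.∣ s n ∣)
cauchy-∣∣ {s} s-cauchy ε 0<ε with s-cauchy ε 0<ε
... | N , close = N , λ m n Nm Nn →
  ℚₚ.≤-trans (reverse-triangle (s m) (s n)) (close m n Nm Nn)

infixl 6 _+ℝ_
infixl 7 _*ℝ_
infix  8 -ℝ_

fromℚ : ℚ → ℝ
fromℚ q .seq _    = q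
fromℚ q .isCauchy = cauchy-const q

0ℝ 1ℝ : ℝ
0ℝ = fromℚ 0ℚ
1ℝ = fromℚ 1ℚ

_+ℝ_ : ℝ → ℝ → ℝ
(x +ℝ y) .seq n    = seq x n ℚ.+ seq y n
(x +ℝ y) .isCauchy = cauchy-+ {seq x} {seq y} (isCauchy x) (isCauchy y)

-ℝ_ : ℝ → ℝ
(-ℝ x) .seq n    = ℚ.- seq x n
(-ℝ x) .isCauchy = cauchy-neg {seq x} (isCauchy x)

_*ℝ_ : ℝ → ℝ → ℝ
(x *ℝ y) .seq n    = seq x n ℚ.* seq y n
(x *ℝ y) .isCauchy =
  let A , 0<A , x-bounded = bounded (seq x) (isCauchy x)
      B , 0<B , y-bounded = bounded (seq y) (isCauchy y)
  in cauchy-* {seq x} {seq y} 0<A 0<B x-bounded y-bounded (isCauchy x) (isCauchy y)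

∣_∣ℝ : ℝ → ℝ
∣ x ∣ℝ .seq n    = ℚ.∣ seq x n ∣
∣ x ∣ℝ .isCauchy = cauchy-∣∣ {seq x} (isCauchy x)

≈ℝ-refl : ∀ {x} → x ≈ℝ x
≈ℝ-refl = ≈-pointwise λ _ → refl

≈ℝ-sym : ∀ {x y} → x ≈ℝ y → y ≈ℝ x
≈ℝ-sym {x} {y} (mk≈ℝ p) = mk≈ℝ (null-cong
  (λ n → neg-difference (seq x n) (seq y n))
  (null-neg p))

≈ℝ-trans : ∀ {x y z} → x ≈ℝ y → y ≈ℝ z → x ≈ℝ z
≈ℝ-trans {x} {y} {z} (mk≈ℝ p) (mk≈ℝ q) = mk≈ℝ (null-cong
  (λ n → difference-trans
    (seq x n) (seq y n) (seq z n))
  (null-+ p q))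

+ℝ-cong : ∀ {x y u v} → x ≈ℝ y → u ≈ℝ v → x +ℝ u ≈ℝ y +ℝ v
+ℝ-cong {x} {y} {u} {v} (mk≈ℝ p) (mk≈ℝ q) = mk≈ℝ (null-cong
  (λ n → difference-+
    (seq x n) (seq y n) (seq u n) (seq v n))
  (null-+ p q))

-ℝ-cong : ∀ {x y} → x ≈ℝ y → -ℝ x ≈ℝ -ℝ y
-ℝ-cong {x} {y} (mk≈ℝ p) = mk≈ℝ (null-cong
  (λ n → trans (neg-difference (seq x n) (seq y n))
    (difference-neg (seq x n) (seq y n)))
  (null-neg p))

*ℝ-cong : ∀ {x y u v} → x ≈ℝ y → u ≈ℝ v → x *ℝ u ≈ℝ y *ℝ v
*ℝ-cong {x} {y} {u} {v} (mk≈ℝ p) (mk≈ℝ q) =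
  let A , 0<A , x-bounded = bounded (seq x) (isCauchy x)
      B , 0<B , v-bounded = bounded (seq v) (isCauchy v)
  in mk≈ℝ (null-cong
    (λ n → difference-* (seq x n) (seq y n) (seq u n) (seq v n))
    (null-+ (null-* 0<A x-bounded q) (null-* 0<B v-bounded p)))

ℝ-commutativeRing : CommutativeRing 0ℓ 0ℓ
ℝ-commutativeRing = record
  { Carrier = ℝ
  ; _≈_     = _≈ℝ_
  ; _+_     = _+ℝ_
  ; _*_     = _*ℝ_
  ; -_      = -ℝ_
  ; 0#      = 0ℝ
  ; 1#      = 1ℝ
  ; isCommutativeRing = record
    { isRing = record
      { +-isAbelianGroup = record
        { isGroup = record
          { isMonoid = record
            { isSemigroup = record
              { isMagma = record
                { isEquivalence = record
                  { refl = ≈ℝ-refl ; sym = ≈ℝ-sym ; trans = ≈ℝ-trans }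
                ; ∙-cong = +ℝ-cong
                }
              ; assoc = λ x y z → ≈-pointwise λ n → ℚₚ.+-assoc (seq x n) (seq y n) (seq z n)
              }
            ; identity = (λ x → ≈-pointwise λ n → ℚₚ.+-identityˡ (seq x n))
                       , (λ x → ≈-pointwise λ n → ℚₚ.+-identityʳ (seq x n))
            }
          ; inverse = (λ x → ≈-pointwise λ n → ℚₚ.+-inverseˡ (seq x n))
                    , (λ x → ≈-pointwise λ n → ℚₚ.+-inverseʳ (seq x n))
          ; ⁻¹-cong = -ℝ-cong
          }
        ; comm = λ x y → ≈-pointwise λ n → ℚₚ.+-comm (seq x n) (seq y n)
        }
      ; *-cong = *ℝ-cong
      ; *-assoc = λ x y z → ≈-pointwise λ n → ℚₚ.*-assoc (seq x n) (seq y n) (seq z n)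
      ; *-identity = (λ x → ≈-pointwise λ n → ℚₚ.*-identityˡ (seq x n))
                   , (λ x → ≈-pointwise λ n → ℚₚ.*-identityʳ (seq x n))
      ; distrib = (λ x y z → ≈-pointwise λ n → ℚₚ.*-distribˡ-+ (seq x n) (seq y n) (seq z n))
                , (λ x y z → ≈-pointwise λ n → ℚₚ.*-distribʳ-+ (seq x n) (seq y n) (seq z n))
      }
    ; *-comm = λ x y → ≈-pointwise λ n → ℚₚ.*-comm (seq x n) (seq y n)
    }
  }

module _ {c ℓ} (L : AbelianGroup c ℓ) where
  open AbelianGroup L
  open RawMonoidDefinitions rawMonoid using (sum) renaming (_×_ to _×ℕ_)

  infixr 8 _·_

  _·_ : ℤ → Carrier → Carrier
  (+ n)    · x = n ×ℕ x
  -[1+ n ] · x = (suc n ×ℕ x) ⁻¹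

  TorsionFree : Set (c ⊔ ℓ)
  TorsionFree = ∀ n x → n ≢ 0ℤ → n · x ≈ ε → x ≈ ε

  LinearlyIndependent : ∀ {n} → Vector Carrier n → Set ℓ
  LinearlyIndependent {n} v = (a : Vector ℤ n) →
    sum (λ i → a i · v i) ≈ ε → ∀ i → a i ≡ 0ℤ

  LinearlyDependent : ∀ {n} → Vector Carrier n → Set ℓ
  LinearlyDependent {n} v = Σ[ a ∈ Vector ℤ n ]
    (∃[ i ] a i ≢ 0ℤ) × sum (λ i → a i · v i) ≈ ε

  -- The rank is the size of a maximal ℤ-linearly independent family.
  HasRank : ℕ → Set (c ⊔ ℓ)
  HasRank n = Σ[ v ∈ Vector Carrier n ]
    LinearlyIndependent v × (∀ x → LinearlyDependent (x ∷ v))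

-- Formal sums of pure tensors, modulo the congruence generated by the
-- abelian group laws and biadditivity of _⊗_, which implies ℤ-bilinearity.

module _ {c ℓ} (L : AbelianGroup c ℓ) where
  private module L = AbelianGroup L

  infix  9 _⊗_
  infix  8 -ᵀ_
  infixl 6 _+ᵀ_
  infix  4 _≈ᵀ_
  infixr 7 _*ᵀ_

  data Tensorℝ : Set c where
    _⊗_  : L.Carrier → ℝ → Tensorℝ
    0ᵀ   : Tensorℝ
    _+ᵀ_ : Tensorℝ → Tensorℝ → Tensorℝ
    -ᵀ_  : Tensorℝ → Tensorℝ

  data _≈ᵀ_ : Tensorℝ → Tensorℝ → Set (c ⊔ ℓ) where
    ≈ᵀ-refl      : ∀ {t} → t ≈ᵀ t
    ≈ᵀ-sym       : ∀ {t u} → t ≈ᵀ u → u ≈ᵀ t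
    ≈ᵀ-trans     : ∀ {t u v} → t ≈ᵀ u → u ≈ᵀ v → t ≈ᵀ v
    +ᵀ-cong      : ∀ {t t′ u u′} → t ≈ᵀ t′ → u ≈ᵀ u′ → t +ᵀ u ≈ᵀ t′ +ᵀ u′
    -ᵀ-cong      : ∀ {t u} → t ≈ᵀ u → -ᵀ t ≈ᵀ -ᵀ u
    ⊗-cong       : ∀ {x y r s} → x L.≈ y → r ≈ℝ s → x ⊗ r ≈ᵀ y ⊗ s
    +ᵀ-assoc     : ∀ t u v → (t +ᵀ u) +ᵀ v ≈ᵀ t +ᵀ (u +ᵀ v)
    +ᵀ-comm      : ∀ t u → t +ᵀ u ≈ᵀ u +ᵀ t
    +ᵀ-identityˡ : ∀ t → 0ᵀ +ᵀ t ≈ᵀ t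
    -ᵀ-inverseˡ  : ∀ t → (-ᵀ t) +ᵀ t ≈ᵀ 0ᵀ
    ⊗-distribˡ   : ∀ x r s → x ⊗ (r +ℝ s) ≈ᵀ x ⊗ r +ᵀ x ⊗ s
    ⊗-distribʳ   : ∀ x y r → (x L.∙ y) ⊗ r ≈ᵀ x ⊗ r +ᵀ y ⊗ r

  _*ᵀ_ : ℝ → Tensorℝ → Tensorℝ
  r *ᵀ (x ⊗ s)  = x ⊗ (r *ℝ s)
  r *ᵀ 0ᵀ       = 0ᵀ
  r *ᵀ (t +ᵀ u) = r *ᵀ t +ᵀ r *ᵀ u
  r *ᵀ (-ᵀ t)   = -ᵀ (r *ᵀ t)

  private
    module R = CommutativeRing ℝ-commutativeRing

    +ᵀ-identityʳ : ∀ t → t +ᵀ 0ᵀ ≈ᵀ t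
    +ᵀ-identityʳ t = ≈ᵀ-trans (+ᵀ-comm t 0ᵀ) (+ᵀ-identityˡ t)

    -ᵀ-inverseʳ : ∀ t → t +ᵀ (-ᵀ t) ≈ᵀ 0ᵀ
    -ᵀ-inverseʳ t = ≈ᵀ-trans (+ᵀ-comm t (-ᵀ t)) (-ᵀ-inverseˡ t)

    tensorGroup : AbelianGroup c (c ⊔ ℓ)
    tensorGroup = record
      { Carrier = Tensorℝ
      ; _≈_ = _≈ᵀ_
      ; _∙_ = _+ᵀ_
      ; ε   = 0ᵀ
      ; _⁻¹ = -ᵀ_
      ; isAbelianGroup = record
        { isGroup = record
          { isMonoid = record
            { isSemigroup = record
              { isMagma = record
                { isEquivalence = record
                  { refl = ≈ᵀ-refl ; sym = ≈ᵀ-sym ; trans = ≈ᵀ-trans }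
                ; ∙-cong = +ᵀ-cong
                }
              ; assoc = +ᵀ-assoc
              }
            ; identity = +ᵀ-identityˡ , +ᵀ-identityʳ
            }
          ; inverse = -ᵀ-inverseˡ , -ᵀ-inverseʳ
          ; ⁻¹-cong = -ᵀ-cong
          }
        ; comm = +ᵀ-comm
        }
      }

    module T = AbelianGroup tensorGroup
    open import Algebra.Properties.AbelianGroup tensorGroup
      using (⁻¹-∙-comm; identityʳ-unique; ε⁻¹≈ε)
    open import Algebra.Properties.CommutativeSemigroup T.commutativeSemigroup
      using (interchange)

    *ᵀ-congˡ : ∀ r {t u} → t ≈ᵀ u → r *ᵀ t ≈ᵀ r *ᵀ u
    *ᵀ-congˡ r ≈ᵀ-refl            = ≈ᵀ-refl
    *ᵀ-congˡ r (≈ᵀ-sym p)         = ≈ᵀ-sym (*ᵀ-congˡ r p)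
    *ᵀ-congˡ r (≈ᵀ-trans p q)     = ≈ᵀ-trans (*ᵀ-congˡ r p) (*ᵀ-congˡ r q)
    *ᵀ-congˡ r (+ᵀ-cong p q)      = +ᵀ-cong (*ᵀ-congˡ r p) (*ᵀ-congˡ r q)
    *ᵀ-congˡ r (-ᵀ-cong p)        = -ᵀ-cong (*ᵀ-congˡ r p)
    *ᵀ-congˡ r (⊗-cong p q)       = ⊗-cong p (*ℝ-cong ≈ℝ-refl q)
    *ᵀ-congˡ r (+ᵀ-assoc t u v)   = +ᵀ-assoc _ _ _
    *ᵀ-congˡ r (+ᵀ-comm t u)      = +ᵀ-comm _ _
    *ᵀ-congˡ r (+ᵀ-identityˡ t)   = +ᵀ-identityˡ _
    *ᵀ-congˡ r (-ᵀ-inverseˡ t)    = -ᵀ-inverseˡ _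
    *ᵀ-congˡ r (⊗-distribˡ x s s′) =
      ≈ᵀ-trans (⊗-cong L.refl (R.distribˡ r s s′)) (⊗-distribˡ x _ _)
    *ᵀ-congˡ r (⊗-distribʳ x y s) = ⊗-distribʳ x y _

    *ᵀ-congʳ : ∀ {r s} t → r ≈ℝ s → r *ᵀ t ≈ᵀ s *ᵀ t
    *ᵀ-congʳ (x ⊗ r)  p = ⊗-cong L.refl (*ℝ-cong p ≈ℝ-refl)
    *ᵀ-congʳ 0ᵀ       p = ≈ᵀ-refl
    *ᵀ-congʳ (t +ᵀ u) p = +ᵀ-cong (*ᵀ-congʳ t p) (*ᵀ-congʳ u p)
    *ᵀ-congʳ (-ᵀ t)   p = -ᵀ-cong (*ᵀ-congʳ t p)

    ⊗-zeroʳ : ∀ x → x ⊗ 0ℝ ≈ᵀ 0ᵀ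
    ⊗-zeroʳ x = identityʳ-unique (x ⊗ 0ℝ) (x ⊗ 0ℝ)
      (≈ᵀ-trans (≈ᵀ-sym (⊗-distribˡ x 0ℝ 0ℝ)) (⊗-cong L.refl (R.+-identityˡ 0ℝ)))

    *ᵀ-zeroˡ : ∀ t → 0ℝ *ᵀ t ≈ᵀ 0ᵀ
    *ᵀ-zeroˡ (x ⊗ r)  = ≈ᵀ-trans (⊗-cong L.refl (R.zeroˡ r)) (⊗-zeroʳ x)
    *ᵀ-zeroˡ 0ᵀ       = ≈ᵀ-refl
    *ᵀ-zeroˡ (t +ᵀ u) = ≈ᵀ-trans (+ᵀ-cong (*ᵀ-zeroˡ t) (*ᵀ-zeroˡ u)) (+ᵀ-identityˡ 0ᵀ)
    *ᵀ-zeroˡ (-ᵀ t)   = ≈ᵀ-trans (-ᵀ-cong (*ᵀ-zeroˡ t)) ε⁻¹≈ε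

    *ᵀ-distribʳ : ∀ t r s → (r +ℝ s) *ᵀ t ≈ᵀ r *ᵀ t +ᵀ s *ᵀ t
    *ᵀ-distribʳ (x ⊗ q)  r s = ≈ᵀ-trans (⊗-cong L.refl (R.distribʳ q r s)) (⊗-distribˡ x _ _)
    *ᵀ-distribʳ 0ᵀ       r s = ≈ᵀ-sym (+ᵀ-identityˡ 0ᵀ)
    *ᵀ-distribʳ (t +ᵀ u) r s = ≈ᵀ-trans
      (+ᵀ-cong (*ᵀ-distribʳ t r s) (*ᵀ-distribʳ u r s))
      (interchange (r *ᵀ t) (s *ᵀ t) (r *ᵀ u) (s *ᵀ u))
    *ᵀ-distribʳ (-ᵀ t)   r s = ≈ᵀ-trans
      (-ᵀ-cong (*ᵀ-distribʳ t r s)) (≈ᵀ-sym (⁻¹-∙-comm (r *ᵀ t) (s *ᵀ t)))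

    *ᵀ-identityˡ : ∀ t → 1ℝ *ᵀ t ≈ᵀ t
    *ᵀ-identityˡ (x ⊗ r)  = ⊗-cong L.refl (R.*-identityˡ r)
    *ᵀ-identityˡ 0ᵀ       = ≈ᵀ-refl
    *ᵀ-identityˡ (t +ᵀ u) = +ᵀ-cong (*ᵀ-identityˡ t) (*ᵀ-identityˡ u)
    *ᵀ-identityˡ (-ᵀ t)   = -ᵀ-cong (*ᵀ-identityˡ t)

    *ᵀ-assoc : ∀ r s t → (r *ℝ s) *ᵀ t ≈ᵀ r *ᵀ (s *ᵀ t)
    *ᵀ-assoc r s (x ⊗ q)  = ⊗-cong L.refl (R.*-assoc r s q)
    *ᵀ-assoc r s 0ᵀ       = ≈ᵀ-refl
    *ᵀ-assoc r s (t +ᵀ u) = +ᵀ-cong (*ᵀ-assoc r s t) (*ᵀ-assoc r s u)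
    *ᵀ-assoc r s (-ᵀ t)   = -ᵀ-cong (*ᵀ-assoc r s t)

  _⊗ℝ : Module ℝ-commutativeRing c (c ⊔ ℓ)
  _⊗ℝ = record
    { Carrierᴹ = Tensorℝ
    ; _≈ᴹ_ = _≈ᵀ_
    ; _+ᴹ_ = _+ᵀ_
    ; _*ₗ_ = _*ᵀ_
    ; _*ᵣ_ = λ t r → r *ᵀ t
    ; 0ᴹ   = 0ᵀ
    ; -ᴹ_  = -ᵀ_
    ; isModule = IsModuleFromLeft.isModule {commutativeRing = ℝ-commutativeRing} (record
      { isLeftModule = record
        { isLeftSemimodule = record
          { +ᴹ-isCommutativeMonoid = T.isCommutativeMonoid
          ; isPreleftSemimodule = record
            { *ₗ-cong = λ {r} {s} {t} {u} r≈s t≈u →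
                ≈ᵀ-trans (*ᵀ-congʳ t r≈s) (*ᵀ-congˡ s t≈u)
            ; *ₗ-zeroˡ = *ᵀ-zeroˡ
            ; *ₗ-distribʳ = *ᵀ-distribʳ
            ; *ₗ-identityˡ = *ᵀ-identityˡ
            ; *ₗ-assoc = *ᵀ-assoc
            ; *ₗ-zeroʳ = λ _ → ≈ᵀ-refl
            ; *ₗ-distribˡ = λ _ _ _ → ≈ᵀ-refl
            }
          }
        ; -ᴹ‿cong = -ᵀ-cong
        ; -ᴹ‿inverse = -ᵀ-inverseˡ , -ᵀ-inverseʳ
        }
      })
    }

module _ {m ℓ} (V : Module ℝ-commutativeRing m ℓ) where
  open Module V

  record IsSemiNorm (‖_‖ : Carrierᴹ → ℝ) : Set (m ⊔ ℓ) where
    field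
      ‖‖-cong     : ∀ {t u} → t ≈ᴹ u → ‖ t ‖ ≈ℝ ‖ u ‖
      nonNegative : ∀ t → 0ℝ ≤ℝ ‖ t ‖
      triangle    : ∀ t u → ‖ t +ᴹ u ‖ ≤ℝ ‖ t ‖ +ℝ ‖ u ‖
      homogeneous : ∀ r t → ‖ r *ₗ t ‖ ≈ℝ ∣ r ∣ℝ *ℝ ‖ t ‖

  IsIsomorphismToℝ : (Carrierᴹ → ℝ) → Set (m ⊔ ℓ)
  IsIsomorphismToℝ =
    ModuleMorphisms.IsModuleIsomorphism rawModule
      (Module.rawModule (TensorUnit.⟨module⟩ {R = ℝ-commutativeRing}))

record ArithmeticDivisor (c ℓ : Level) : Set (lsuc (c ⊔ ℓ)) where
  field
    L           : AbelianGroup c ℓ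
    torsionFree : TorsionFree L
    rank-one    : HasRank L 1
    ‖_‖         : Tensorℝ L → ℝ
    -- Also a consequence of form.
    isSemiNorm  : IsSemiNorm (L ⊗ℝ) ‖_‖
    form        : Σ[ λ₀ ∈ ℝ ] Σ[ φ ∈ (Tensorℝ L → ℝ) ]
                    0ℝ ≤ℝ λ₀ × IsIsomorphismToℝ (L ⊗ℝ) φ ×
                    (∀ t → ‖ t ‖ ≈ℝ λ₀ *ℝ ∣ φ t ∣ℝ)

  open AbelianGroup L public using (Carrier; rawGroup)

  -- An element x of L is identified with x ⊗ 1.
  ‖_‖ᴸ : Carrier → ℝ
  ‖ x ‖ᴸ = ‖ x ⊗ 1ℝ ‖

  NonDegenerate : Set c
  NonDegenerate = ¬ (∀ t → ‖ t ‖ ≈ℝ 0ℝ)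

  S : Pred ℝ c
  S r = ∃[ x ] ‖ x ‖ᴸ ≈ℝ r

open ArithmeticDivisor public using (NonDegenerate; S)

infix 4 _≅_

record _≅_ {c₁ ℓ₁ c₂ ℓ₂}
           (D₁ : ArithmeticDivisor c₁ ℓ₁) (D₂ : ArithmeticDivisor c₂ ℓ₂)
           : Set (c₁ ⊔ ℓ₁ ⊔ c₂ ⊔ ℓ₂) where
  private
    module D₁ = ArithmeticDivisor D₁
    module D₂ = ArithmeticDivisor D₂
  field
    ψ             : D₁.Carrier → D₂.Carrier
    isIsomorphism : GroupMorphisms.IsGroupIsomorphism D₁.rawGroup D₂.rawGroup ψ
    isometric     : ∀ x → D₂.‖ ψ x ‖ᴸ ≈ℝ D₁.‖ x ‖ᴸ

{-# OPTIONS --safe #-}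

-- For v ≠ 0 in L, every x ∈ L has a rational coordinate q with x ⊗ 1 = v ⊗ q, which
-- determines x, and ‖x‖ = |q| ‖v‖. If y₀ ∈ L₂ has the norm of v₁ and r is its coordinate,
-- then ‖v₁‖ = |r| ‖v₂‖ with r ≠ 0. As ‖v₂‖ ≠ 0, two elements of equal norm have coordinates
-- p in L₁ and ± p r in L₂; so the equality of the sets of norms says that p ↦ p r carries the
-- coordinates of L₁ onto those of L₂. Since r is a rational, every case distinction is
-- decidable, although equality of reals is not.

module Submission where

open import Defs
open import Algebra.Bundles using (AbelianGroup; CommutativeRing)
import Algebra.Definitions.RawMonoid as RawMonoidDefinitions
open import Algebra.Module.Bundles using (Module)
import Algebra.Module.Properties as ModuleProperties
open import Algebra.Morphism.Structures using (IsMagmaHomomorphism; IsGroupIsomorphism)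
import Algebra.Properties.AbelianGroup as AbelianGroupProperties
import Algebra.Properties.CommutativeMonoid.Mult as Mult
import Algebra.Properties.CommutativeSemigroup as CommutativeSemigroupProperties
import Algebra.Properties.Ring as RingProperties
import Algebra.Properties.Semiring.Mult as SemiringMult
open import Data.Fin.Base using (zero; suc)
open import Data.Integer.Base using (ℤ; +_; -[1+_]; 0ℤ)
open import Data.Nat.Base as ℕ using (ℕ; zero; suc)
import Data.Nat.Properties as ℕₚ
open import Data.Product using (∃-syntax; _×_; _,_; proj₁; proj₂)
open import Data.Rational.Base as ℚ using (ℚ; 0ℚ; 1ℚ)
import Data.Rational.Properties as ℚₚ
open import Data.Sum.Base using (_⊎_; inj₁; inj₂)
open import Function.Bundles using (_⇔_; mk⇔)
open import Level using (Level; _⊔_)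
open import Relation.Binary.PropositionalEquality as ≡ using (_≡_; _≢_; cong)
import Relation.Binary.Reasoning.Setoid as SetoidReasoning
open import Relation.Nullary using (¬_; yes; no; contradiction)
open import Relation.Unary using (_≐_)

private
  variable
    c ℓ c₁ ℓ₁ c₂ ℓ₂ c₃ ℓ₃ : Level

-- Natural multiples in abelian groups.

module NaturalMultiples (G : AbelianGroup c ℓ) where
  open AbelianGroup G
  open Mult commutativeMonoid public using (×-congʳ; ×-homo-+; ×-assocˡ; ×-distrib-+)
  open RawMonoidDefinitions rawMonoid public using () renaming (_×_ to _×ℕ_)
  open AbelianGroupProperties G using (∙-cancelˡ; inverseˡ-unique; x∙y⁻¹≈ε⇒x≈y)
  open SetoidReasoning setoid

  ℕ-TorsionFree : Set _
  ℕ-TorsionFree = ∀ n x → suc n ×ℕ x ≈ ε → x ≈ ε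

  -- Cancelling one `v` on each side lowers both multiples; if only one of them is zero, a positive
  -- multiple of `v` would vanish.
  ×-injectiveˡ : ℕ-TorsionFree → ∀ {v} → ¬ v ≈ ε → ∀ m n → m ×ℕ v ≈ n ×ℕ v → m ≡ n
  ×-injectiveˡ tf v≉ε zero    zero    _  = ≡.refl
  ×-injectiveˡ tf v≉ε zero    (suc n) eq = contradiction (tf n _ (sym eq)) v≉ε
  ×-injectiveˡ tf v≉ε (suc m) zero    eq = contradiction (tf m _ eq) v≉ε
  ×-injectiveˡ tf v≉ε (suc m) (suc n) eq =
    cong suc (×-injectiveˡ tf v≉ε m n (∙-cancelˡ _ _ _ eq))

  ×-zeroʳ : ∀ n → n ×ℕ ε ≈ ε
  ×-zeroʳ zero    = refl
  ×-zeroʳ (suc n) = trans (identityˡ _) (×-zeroʳ n)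

  ×-⁻¹ : ∀ n x → n ×ℕ (x ⁻¹) ≈ (n ×ℕ x) ⁻¹
  ×-⁻¹ n x = inverseˡ-unique _ _ (begin
    n ×ℕ (x ⁻¹) ∙ n ×ℕ x  ≈⟨ ×-distrib-+ (x ⁻¹) x n ⟨
    n ×ℕ (x ⁻¹ ∙ x)       ≈⟨ ×-congʳ n (inverseˡ x) ⟩
    n ×ℕ ε                ≈⟨ ×-zeroʳ n ⟩
    ε                     ∎)

  ×-injectiveʳ : ℕ-TorsionFree → ∀ n {x y} → suc n ×ℕ x ≈ suc n ×ℕ y → x ≈ y
  ×-injectiveʳ tf n {x} {y} eq = x∙y⁻¹≈ε⇒x≈y x y (tf n _ (begin
    suc n ×ℕ (x ∙ y ⁻¹)               ≈⟨ ×-distrib-+ x (y ⁻¹) (suc n) ⟩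
    suc n ×ℕ x ∙ suc n ×ℕ (y ⁻¹)      ≈⟨ ∙-cong eq (×-⁻¹ (suc n) y) ⟩
    suc n ×ℕ y ∙ (suc n ×ℕ y) ⁻¹      ≈⟨ inverseʳ _ ⟩
    ε                                 ∎))

-- Linear relations with a fixed element.

module LinearRelation (G : AbelianGroup c ℓ) (v : AbelianGroup.Carrier G) where
  open AbelianGroup G
  open NaturalMultiples G
  open AbelianGroupProperties G using (∙-cancelʳ; xyx⁻¹≈y)
  open CommutativeSemigroupProperties commutativeSemigroup using (interchange)
  open SetoidReasoning setoid

  -- For positive `d` this is x = ((k - m) / d) v with the denominator cleared and the subtraction
  -- moved to the other side.
  Relation : ℕ → ℕ → ℕ → Carrier → Set ℓ
  Relation d m k x = d ×ℕ x ∙ m ×ℕ v ≈ k ×ℕ v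

  relation-cong : ∀ d m k {x y} → x ≈ y → Relation d m k x → Relation d m k y
  relation-cong d m k x≈y eq = trans (∙-congʳ (×-congʳ d (sym x≈y))) eq

  relation-scale : ∀ e d m k {x} → Relation d m k x →
                   Relation (e ℕ.* d) (e ℕ.* m) (e ℕ.* k) x
  relation-scale e d m k {x} eq = begin
    (e ℕ.* d) ×ℕ x ∙ (e ℕ.* m) ×ℕ v  ≈⟨ ∙-cong (×-assocˡ x e d) (×-assocˡ v e m) ⟨
    e ×ℕ (d ×ℕ x) ∙ e ×ℕ (m ×ℕ v)    ≈⟨ ×-distrib-+ _ _ e ⟨
    e ×ℕ (d ×ℕ x ∙ m ×ℕ v)           ≈⟨ ×-congʳ e eq ⟩
    e ×ℕ (k ×ℕ v)                    ≈⟨ ×-assocˡ v e k ⟩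
    (e ℕ.* k) ×ℕ v                   ∎

  relation-∙ : ∀ d m k m′ k′ {x y} → Relation d m k x → Relation d m′ k′ y →
               Relation d (m ℕ.+ m′) (k ℕ.+ k′) (x ∙ y)
  relation-∙ d m k m′ k′ {x} {y} eq eq′ = begin
    d ×ℕ (x ∙ y) ∙ (m ℕ.+ m′) ×ℕ v               ≈⟨ ∙-cong (×-distrib-+ x y d) (×-homo-+ v m m′) ⟩
    (d ×ℕ x ∙ d ×ℕ y) ∙ (m ×ℕ v ∙ m′ ×ℕ v)       ≈⟨ interchange _ _ _ _ ⟩
    (d ×ℕ x ∙ m ×ℕ v) ∙ (d ×ℕ y ∙ m′ ×ℕ v)       ≈⟨ ∙-cong eq eq′ ⟩
    k ×ℕ v ∙ k′ ×ℕ v                             ≈⟨ ×-homo-+ v k k′ ⟨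
    (k ℕ.+ k′) ×ℕ v                              ∎

  -- Addition of fractions over the common denominator `d ℕ.* d′`: the first relation is scaled by
  -- `d′` and the second by `d`.
  relation-add : ∀ d m k d′ m′ k′ {x y} → Relation d m k x → Relation d′ m′ k′ y →
                 Relation (d ℕ.* d′) (d′ ℕ.* m ℕ.+ d ℕ.* m′) (d′ ℕ.* k ℕ.+ d ℕ.* k′) (x ∙ y)
  relation-add d m k d′ m′ k′ {x} {y} eq eq′ =
    relation-∙ (d ℕ.* d′) (d′ ℕ.* m) (d′ ℕ.* k) (d ℕ.* m′) (d ℕ.* k′)
      (≡.subst (λ e → Relation e (d′ ℕ.* m) (d′ ℕ.* k) x) (ℕₚ.*-comm d′ d)
        (relation-scale d′ d m k eq))
      (relation-scale d d′ m′ k′ eq′)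

  relation-⁻¹ : ∀ d m k {x} → Relation d m k x → Relation d k m (x ⁻¹)
  relation-⁻¹ d m k {x} eq = begin
    d ×ℕ (x ⁻¹) ∙ k ×ℕ v                   ≈⟨ ∙-cong (×-⁻¹ d x) (sym eq) ⟩
    (d ×ℕ x) ⁻¹ ∙ (d ×ℕ x ∙ m ×ℕ v)        ≈⟨ comm _ _ ⟩
    (d ×ℕ x ∙ m ×ℕ v) ∙ (d ×ℕ x) ⁻¹        ≈⟨ xyx⁻¹≈y _ _ ⟩
    m ×ℕ v                                 ∎

  relation-ε : ∀ d m k → Relation d m k ε → m ×ℕ v ≈ k ×ℕ v
  relation-ε d m k eq = trans (sym (identityˡ _)) (trans (∙-congʳ (sym (×-zeroʳ d))) eq)

  relation-diagonal : ∀ d m {x} → Relation d m m x → d ×ℕ x ≈ ε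
  relation-diagonal d m eq = ∙-cancelʳ (m ×ℕ v) _ _ (trans eq (sym (identityˡ _)))

-- a ∼ b says that a / v and b / w are the same rational number (k − m) / (d + 1);
-- natural coefficients on both sides avoid the action of ℤ.

module Proportional (A : AbelianGroup c₁ ℓ₁) (v : AbelianGroup.Carrier A)
                    (B : AbelianGroup c₂ ℓ₂) (w : AbelianGroup.Carrier B) where
  private
    module A = AbelianGroup A
    module B = AbelianGroup B
    module Aᴹ = NaturalMultiples A
    module Bᴹ = NaturalMultiples B
    module Aᴿ = LinearRelation A v
    module Bᴿ = LinearRelation B w

  infix 4 _∼_

  record _∼_ (a : A.Carrier) (b : B.Carrier) : Set (ℓ₁ ⊔ ℓ₂) where
    constructor proportional
    field
      d m k     : ℕ
      relationˡ : Aᴿ.Relation (suc d) m k a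
      relationʳ : Bᴿ.Relation (suc d) m k b

  ∼-resp : ∀ {a a′ b b′} → a A.≈ a′ → b B.≈ b′ → a ∼ b → a′ ∼ b′
  ∼-resp a≈a′ b≈b′ (proportional d m k p q) = proportional d m k
    (Aᴿ.relation-cong (suc d) m k a≈a′ p) (Bᴿ.relation-cong (suc d) m k b≈b′ q)

  ∼-∙ : ∀ {a a′ b b′} → a ∼ b → a′ ∼ b′ → a A.∙ a′ ∼ b B.∙ b′
  ∼-∙ (proportional d m k p q) (proportional d′ m′ k′ p′ q′) = proportional
    -- The record stores the denominator minus one; this is the predecessor of `suc d ℕ.* suc d′`.
    (d′ ℕ.+ d ℕ.* suc d′) (suc d′ ℕ.* m ℕ.+ suc d ℕ.* m′) (suc d′ ℕ.* k ℕ.+ suc d ℕ.* k′)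
    (Aᴿ.relation-add (suc d) m k (suc d′) m′ k′ p p′)
    (Bᴿ.relation-add (suc d) m k (suc d′) m′ k′ q q′)

  ∼-⁻¹ : ∀ {a b} → a ∼ b → a A.⁻¹ ∼ b B.⁻¹
  ∼-⁻¹ (proportional d m k p q) = proportional d k m
    (Aᴿ.relation-⁻¹ (suc d) m k p) (Bᴿ.relation-⁻¹ (suc d) m k q)

  ∼-base : v ∼ w
  ∼-base = proportional 0 0 1 (A.identityʳ _) (B.identityʳ _)

  module _ (A-tf : Aᴹ.ℕ-TorsionFree) (B-tf : Bᴹ.ℕ-TorsionFree) (w≉ε : ¬ w B.≈ B.ε) where

    -- The relation for `B.ε` reduces to `m ×ℕ w ≈ k ×ℕ w`, so `m` and `k` coincide; the relation in
    -- `A` then says that a positive multiple of `a` vanishes.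
    ∼ε⇒≈ε : ∀ {a} → a ∼ B.ε → a A.≈ A.ε
    ∼ε⇒≈ε (proportional d m k p q)
      with ≡.refl ← Bᴹ.×-injectiveˡ B-tf w≉ε m k (Bᴿ.relation-ε (suc d) m k q)
      = A-tf d _ (Aᴿ.relation-diagonal (suc d) m p)

    -- The difference of `a` and `a′` is proportional to the difference of `b` with itself.
    ∼-uniqueˡ : ∀ {a a′ b} → a ∼ b → a′ ∼ b → a A.≈ a′
    ∼-uniqueˡ a∼b a′∼b = AbelianGroupProperties.x∙y⁻¹≈ε⇒x≈y A _ _
      (∼ε⇒≈ε (∼-resp A.refl (B.inverseʳ _) (∼-∙ a∼b (∼-⁻¹ a′∼b))))

∼-swap : ∀ (A : AbelianGroup c₁ ℓ₁) v (B : AbelianGroup c₂ ℓ₂) w {a b} →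
         Proportional._∼_ A v B w a b → Proportional._∼_ B w A v b a
∼-swap A v B w (Proportional.proportional d m k p q) = Proportional.proportional d m k q p

-- Homomorphisms applied to proportional elements.

module _ (A : AbelianGroup c₁ ℓ₁) (C : AbelianGroup c₃ ℓ₃) where
  private
    module A = AbelianGroup A
    module C = AbelianGroup C
    module Aᴹ = NaturalMultiples A
    module Cᴹ = NaturalMultiples C

  ×-homo : ∀ {f} → IsMagmaHomomorphism A.rawMagma C.rawMagma f →
           ∀ n x → f (n Aᴹ.×ℕ x) C.≈ n Cᴹ.×ℕ f x
  -- A magma homomorphism only respects sums; `f A.ε` is trivial because it is idempotent in a
  -- group.
  ×-homo {f} f-hom zero x = AbelianGroupProperties.identityʳ-unique C (f A.ε) (f A.ε)
    (C.trans (C.sym (homo A.ε A.ε)) (⟦⟧-cong (A.identityˡ A.ε)))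
    where open IsMagmaHomomorphism f-hom
  ×-homo {f} f-hom (suc n) x = C.trans (homo x _) (C.∙-congˡ (×-homo f-hom n x))
    where open IsMagmaHomomorphism f-hom

  relation-homo : ∀ {f v} → IsMagmaHomomorphism A.rawMagma C.rawMagma f → ∀ d m k {x} →
                  LinearRelation.Relation A v d m k x → LinearRelation.Relation C (f v) d m k (f x)
  relation-homo {f} {v} f-hom d m k {x} eq = begin
    d Cᴹ.×ℕ f x C.∙ m Cᴹ.×ℕ f v        ≈⟨ C.∙-cong (×-homo f-hom d x) (×-homo f-hom m v) ⟨
    f (d Aᴹ.×ℕ x) C.∙ f (m Aᴹ.×ℕ v)    ≈⟨ homo _ _ ⟨
    f (d Aᴹ.×ℕ x A.∙ m Aᴹ.×ℕ v)        ≈⟨ ⟦⟧-cong eq ⟩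
    f (k Aᴹ.×ℕ v)                      ≈⟨ ×-homo f-hom k v ⟩
    k Cᴹ.×ℕ f v                        ∎
    where
    open IsMagmaHomomorphism f-hom
    open SetoidReasoning C.setoid

module _ (A : AbelianGroup c₁ ℓ₁) (B : AbelianGroup c₂ ℓ₂) (C : AbelianGroup c₃ ℓ₃) where
  private
    module A = AbelianGroup A
    module B = AbelianGroup B
    module C = AbelianGroup C
    module Cᴹ = NaturalMultiples C

  -- Both images satisfy the same relation over the common base point in `C`; cancelling the
  -- multiple of that point and then the factor `suc d` identifies them.
  homomorphisms-agree : Cᴹ.ℕ-TorsionFree → ∀ {f g v w} →
    IsMagmaHomomorphism A.rawMagma C.rawMagma f → IsMagmaHomomorphism B.rawMagma C.rawMagma g →
    f v C.≈ g w → ∀ {a b} → Proportional._∼_ A v B w a b → f a C.≈ g b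
  homomorphisms-agree C-tf {f} {g} {v} {w} f-hom g-hom fv≈gw {a} {b} (Proportional.proportional d m k p q) =
    Cᴹ.×-injectiveʳ C-tf d (AbelianGroupProperties.∙-cancelʳ C (m Cᴹ.×ℕ f v) _ _ (begin
      suc d Cᴹ.×ℕ f a C.∙ m Cᴹ.×ℕ f v  ≈⟨ relation-homo A C f-hom (suc d) m k p ⟩
      k Cᴹ.×ℕ f v                      ≈⟨ Cᴹ.×-congʳ k fv≈gw ⟩
      k Cᴹ.×ℕ g w                      ≈⟨ relation-homo B C g-hom (suc d) m k q ⟨
      suc d Cᴹ.×ℕ g b C.∙ m Cᴹ.×ℕ g w  ≈⟨ C.∙-congˡ (Cᴹ.×-congʳ m fv≈gw) ⟨
      suc d Cᴹ.×ℕ g b C.∙ m Cᴹ.×ℕ f v  ∎))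
    where open SetoidReasoning C.setoid

-- Rational numbers and their action on the reals.

ℚ⁺ : AbelianGroup _ _
ℚ⁺ = ℚₚ.+-0-abelianGroup

open NaturalMultiples ℚ⁺ using () renaming (_×ℕ_ to _×ℚ_; ℕ-TorsionFree to ℚ-TorsionFree)
open SemiringMult (CommutativeRing.semiring ℚₚ.+-*-commutativeRing) using (×-assoc-*)

×1-nonNeg : ∀ n → 0ℚ ℚ.≤ n ×ℚ 1ℚ
×1-nonNeg zero    = ℚₚ.≤-refl
×1-nonNeg (suc n) = ℚₚ.+-mono-≤ (ℚₚ.<⇒≤ (ℚₚ.positive⁻¹ 1ℚ)) (×1-nonNeg n)

×1-invertible : ∀ n → ∃[ q ] 0ℚ ℚ.< q × (suc n ×ℚ 1ℚ) ℚ.* q ≡ 1ℚ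
×1-invertible n = scale-down (suc n ×ℚ 1ℚ) 1ℚ
  (ℚₚ.+-mono-<-≤ (ℚₚ.positive⁻¹ 1ℚ) (×1-nonNeg n)) (ℚₚ.positive⁻¹ 1ℚ)

1/[1+_] : ℕ → ℚ
1/[1+ n ] = proj₁ (×1-invertible n)

×1-inverse : ∀ n → (suc n ×ℚ 1ℚ) ℚ.* 1/[1+ n ] ≡ 1ℚ
×1-inverse n = proj₂ (proj₂ (×1-invertible n))

×ℚ-as-* : ∀ n q → n ×ℚ q ≡ (n ×ℚ 1ℚ) ℚ.* q
×ℚ-as-* n q = ≡.sym (≡.trans (×-assoc-* n 1ℚ q) (cong (n ×ℚ_) (ℚₚ.*-identityˡ q)))

×ℚ-inverse : ∀ n q → suc n ×ℚ (1/[1+ n ] ℚ.* q) ≡ q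
×ℚ-inverse n q = begin
  suc n ×ℚ (1/[1+ n ] ℚ.* q)              ≡⟨ ×ℚ-as-* (suc n) _ ⟩
  (suc n ×ℚ 1ℚ) ℚ.* (1/[1+ n ] ℚ.* q)     ≡⟨ ℚₚ.*-assoc (suc n ×ℚ 1ℚ) _ q ⟨
  (suc n ×ℚ 1ℚ) ℚ.* 1/[1+ n ] ℚ.* q       ≡⟨ cong (ℚ._* q) (×1-inverse n) ⟩
  1ℚ ℚ.* q                                ≡⟨ ℚₚ.*-identityˡ q ⟩
  q                                       ∎
  where open ≡.≡-Reasoning

ℚ-torsionFree : ℚ-TorsionFree
ℚ-torsionFree n q eq = begin
  q                                       ≡⟨ ℚₚ.*-identityˡ q ⟨
  1ℚ ℚ.* q                                ≡⟨ cong (ℚ._* q) (≡.trans (ℚₚ.*-comm 1/[1+ n ] _) (×1-inverse n)) ⟨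
  1/[1+ n ] ℚ.* (suc n ×ℚ 1ℚ) ℚ.* q       ≡⟨ ℚₚ.*-assoc 1/[1+ n ] _ q ⟩
  1/[1+ n ] ℚ.* ((suc n ×ℚ 1ℚ) ℚ.* q)     ≡⟨ cong (1/[1+ n ] ℚ.*_) (≡.trans (≡.sym (×ℚ-as-* (suc n) q)) eq) ⟩
  1/[1+ n ] ℚ.* 0ℚ                        ≡⟨ ℚₚ.*-zeroʳ 1/[1+ n ] ⟩
  0ℚ                                      ∎
  where open ≡.≡-Reasoning

1≢0 : 1ℚ ≢ 0ℚ
1≢0 ()

-- The solution is (k - m) / (d + 1). It supplies the coordinate of any element of L subject to the
-- same relation.
relation-solution : ∀ d m k → ∃[ q ] LinearRelation.Relation ℚ⁺ 1ℚ (suc d) m k q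
relation-solution d m k = 1/[1+ d ] ℚ.* (k ×ℚ 1ℚ ℚ.- m ×ℚ 1ℚ) , (begin
  suc d ×ℚ (1/[1+ d ] ℚ.* (k ×ℚ 1ℚ ℚ.- m ×ℚ 1ℚ)) ℚ.+ m ×ℚ 1ℚ  ≡⟨ cong (ℚ._+ m ×ℚ 1ℚ) (×ℚ-inverse d _) ⟩
  k ×ℚ 1ℚ ℚ.- m ×ℚ 1ℚ ℚ.+ m ×ℚ 1ℚ                             ≡⟨ ℚₚ.+-comm (k ×ℚ 1ℚ ℚ.- m ×ℚ 1ℚ) _ ⟩
  m ×ℚ 1ℚ ℚ.+ (k ×ℚ 1ℚ ℚ.- m ×ℚ 1ℚ)                           ≡⟨ cancel-middle (k ×ℚ 1ℚ) (m ×ℚ 1ℚ) ⟩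
  k ×ℚ 1ℚ                                                     ∎)
  where open ≡.≡-Reasoning

∣∣≡⇒≡∨≡- : ∀ p q → ℚ.∣ p ∣ ≡ ℚ.∣ q ∣ → p ≡ q ⊎ ℚ.- p ≡ q
∣∣≡⇒≡∨≡- p q eq with ℚₚ.∣p∣≡p∨∣p∣≡-p p | ℚₚ.∣p∣≡p∨∣p∣≡-p q
... | inj₁ a | inj₁ b = inj₁ (≡.trans (≡.sym a) (≡.trans eq b))
... | inj₁ a | inj₂ b = inj₂ (≡.trans (cong ℚ.-_ (≡.trans (≡.sym a) (≡.trans eq b))) (⁻¹-involutive q))
  where open AbelianGroupProperties ℚ⁺
... | inj₂ a | inj₁ b = inj₂ (≡.trans (≡.sym a) (≡.trans eq b))
... | inj₂ a | inj₂ b = inj₁ (⁻¹-injective (≡.trans (≡.sym a) (≡.trans eq b)))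
  where open AbelianGroupProperties ℚ⁺

-- Equality of rationals is decidable, so it suffices to refute `p ≢ q`. In that case ρ = (pρ - qρ)
-- / (p - q) would be zero; the division is by a rational, never by `ρ`.
*ℝ-cancelʳ-fromℚ : ∀ {ρ} → ¬ ρ ≈ℝ 0ℝ → ∀ p q → fromℚ p *ℝ ρ ≈ℝ fromℚ q *ℝ ρ → p ≡ q
*ℝ-cancelʳ-fromℚ {ρ} ρ≉0 p q eq with p ℚₚ.≟ q
... | yes p≡q = p≡q
... | no  p≢q = contradiction ρ≈0 ρ≉0
  where
  instance
    p-q≢0 : ℚ.NonZero (p ℚ.- q)
    p-q≢0 = ℚ.≢-nonZero λ p-q≡0 →
      p≢q (AbelianGroupProperties.x∙y⁻¹≈ε⇒x≈y ℚ⁺ p q p-q≡0)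

  s : ℚ
  s = ℚ.1/ (p ℚ.- q)

  pointwise : ∀ x → x ≡ s ℚ.* (p ℚ.* x ℚ.- q ℚ.* x)
  pointwise x = begin
    x                                    ≡⟨ ℚₚ.*-identityˡ x ⟨
    1ℚ ℚ.* x                             ≡⟨ cong (ℚ._* x) (ℚₚ.*-inverseˡ (p ℚ.- q)) ⟨
    s ℚ.* (p ℚ.- q) ℚ.* x                ≡⟨ ℚₚ.*-assoc s (p ℚ.- q) x ⟩
    s ℚ.* ((p ℚ.- q) ℚ.* x)              ≡⟨ cong (s ℚ.*_) ([y-z]x≈yx-zx x p q) ⟩
    s ℚ.* (p ℚ.* x ℚ.- q ℚ.* x)          ∎
    where
    open ≡.≡-Reasoning
    open RingProperties ℚₚ.+-*-ring using ([y-z]x≈yx-zx)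

  ρ≈0 : ρ ≈ℝ 0ℝ
  ρ≈0 = begin
    ρ                                                     ≈⟨ ≈-pointwise (λ n → pointwise (seq ρ n)) ⟩
    fromℚ s *ℝ (fromℚ p *ℝ ρ +ℝ (-ℝ (fromℚ q *ℝ ρ)))      ≈⟨ *-congˡ (+-congʳ eq) ⟩
    fromℚ s *ℝ (fromℚ q *ℝ ρ +ℝ (-ℝ (fromℚ q *ℝ ρ)))      ≈⟨ *-congˡ (-‿inverseʳ _) ⟩
    fromℚ s *ℝ 0ℝ                                         ≈⟨ zeroʳ (fromℚ s) ⟩
    0ℝ                                                    ∎
    where
    open CommutativeRing ℝ-commutativeRing
    open SetoidReasoning setoid

-- Torsion-freeness of real modules.

module RealModule {m ℓ} (V : Module ℝ-commutativeRing m ℓ) where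
  open Module V
  open NaturalMultiples +ᴹ-abelianGroup
  open SetoidReasoning (AbelianGroup.setoid +ᴹ-abelianGroup)

  ×-as-*ₗ : ∀ n t → fromℚ (n ×ℚ 1ℚ) *ₗ t ≈ᴹ n ×ℕ t
  ×-as-*ₗ zero    t = *ₗ-zeroˡ t
  ×-as-*ₗ (suc n) t = begin
    fromℚ (1ℚ ℚ.+ n ×ℚ 1ℚ) *ₗ t         ≈⟨ *ₗ-congʳ (≈-pointwise λ _ → ≡.refl) ⟩
    (1ℝ +ℝ fromℚ (n ×ℚ 1ℚ)) *ₗ t        ≈⟨ *ₗ-distribʳ t _ _ ⟩
    1ℝ *ₗ t +ᴹ fromℚ (n ×ℚ 1ℚ) *ₗ t     ≈⟨ +ᴹ-cong (*ₗ-identityˡ t) (×-as-*ₗ n t) ⟩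
    t +ᴹ n ×ℕ t                         ∎

  -- The real scalar 1 / (n + 1) undoes multiplication by `suc n`.
  ℕ-torsionFree : ℕ-TorsionFree
  ℕ-torsionFree n t eq = begin
    t                                               ≈⟨ *ₗ-identityˡ t ⟨
    1ℝ *ₗ t                                         ≈⟨ *ₗ-congʳ (≈-pointwise λ _ → ≡.trans (ℚₚ.*-comm 1/[1+ n ] _) (×1-inverse n)) ⟨
    (fromℚ 1/[1+ n ] *ℝ fromℚ (suc n ×ℚ 1ℚ)) *ₗ t   ≈⟨ *ₗ-assoc _ _ t ⟩
    fromℚ 1/[1+ n ] *ₗ (fromℚ (suc n ×ℚ 1ℚ) *ₗ t)   ≈⟨ *ₗ-congˡ (×-as-*ₗ (suc n) t) ⟩
    fromℚ 1/[1+ n ] *ₗ (suc n ×ℕ t)                 ≈⟨ *ₗ-congˡ eq ⟩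
    fromℚ 1/[1+ n ] *ₗ 0ᴹ                           ≈⟨ *ₗ-zeroʳ _ ⟩
    0ᴹ                                              ∎

-- Rational coordinates on an arithmetic divisor.

module Coordinates (D : ArithmeticDivisor c ℓ) where
  open ArithmeticDivisor D hiding (NonDegenerate; S)
  private
    module L = AbelianGroup L
    open L using (_≈_; ε; _∙_; _⁻¹)
    module M = Module (L ⊗ℝ)
    module R = CommutativeRing ℝ-commutativeRing
    open NaturalMultiples L
    open IsSemiNorm isSemiNorm
    open AbelianGroupProperties L
      using (⁻¹-involutive; ⁻¹-∙-comm; ⁻¹-injective; ε⁻¹≈ε; inverseʳ-unique; x∙y⁻¹≈ε⇒x≈y)

    infixr 8 _•_
    _•_ : ℤ → L.Carrier → L.Carrier
    _•_ = _·_ L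

  v : Carrier
  v = proj₁ rank-one zero

  open Proportional L v ℚ⁺ 1ℚ public

  L-torsionFree : ℕ-TorsionFree
  L-torsionFree n x = torsionFree (+ suc n) x λ ()

  v≉ε : ¬ v ≈ ε
  -- If `v` were trivial, the coefficient 1 would contradict the independence of the family
  -- consisting of `v` alone.
  v≉ε v≈ε with () ← proj₁ (proj₂ rank-one) (λ _ → + 1)
    (L.trans (L.identityʳ _) (L.trans (L.identityʳ v) v≈ε)) zero

  private
    solve : ∀ d m k {x} → LinearRelation.Relation L v (suc d) m k x → ∃[ q ] x ∼ q
    solve d m k rel = let q , rel′ = relation-solution d m k in q , proportional d m k rel rel′

    -- The signs of `a` and `b` decide on which side the multiple of `v` must stand for all
    -- coefficients to become natural; a negative `a` is handled by negating the whole equation.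
    from-dependence : ∀ a b x → a ≢ 0ℤ → a • x ∙ b • v ≈ ε → ∃[ q ] x ∼ q
    from-dependence (+ zero)  b        x a≢0 eq = contradiction ≡.refl a≢0
    from-dependence (+ suc d) (+ m)    x a≢0 eq = solve d m 0 eq
    from-dependence (+ suc d) -[1+ k ] x a≢0 eq =
      solve d 0 (suc k) (L.trans (L.identityʳ _) (x∙y⁻¹≈ε⇒x≈y _ _ eq))
    from-dependence -[1+ d ]  (+ k)    x a≢0 eq =
      solve d 0 k (L.trans (L.identityʳ _)
        (L.sym (L.trans (inverseʳ-unique _ _ eq) (⁻¹-involutive _))))
    from-dependence -[1+ d ]  -[1+ m ] x a≢0 eq =
      solve d (suc m) 0 (⁻¹-injective
        (L.trans (L.sym (⁻¹-∙-comm _ _)) (L.trans eq (L.sym ε⁻¹≈ε))))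

  coordinate : ∀ x → ∃[ q ] x ∼ q
  coordinate x with proj₂ (proj₂ rank-one) x
  ... | a , (i , aᵢ≢0) , eq =
    from-dependence (a zero) (a (suc zero)) x a₀≢0 (L.trans (L.∙-congˡ (L.sym (L.identityʳ _))) eq)
    where
    -- If the coefficient of `x` vanished, independence of `v` would make the other one vanish too,
    -- against the nontriviality of the dependence.
    a₀≢0 : a zero ≢ 0ℤ
    a₀≢0 a₀≡0 = aᵢ≢0 (all-zero i)
      where
      b•v≈ε : a (suc zero) • v ∙ ε ≈ ε
      b•v≈ε = L.trans (L.sym (L.identityˡ _))
        (≡.subst (λ a₀ → a₀ • x ∙ (a (suc zero) • v ∙ ε) ≈ ε) a₀≡0 eq)

      all-zero : ∀ i → a i ≡ 0ℤ
      all-zero zero       = a₀≡0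
      all-zero (suc zero) = proj₁ (proj₂ rank-one) (λ _ → a (suc zero)) b•v≈ε zero

  ∼-uniqueᴸ : ∀ {x y q} → x ∼ q → y ∼ q → x ≈ y
  ∼-uniqueᴸ = ∼-uniqueˡ L-torsionFree ℚ-torsionFree 1≢0

  ∼-uniqueℚ : ∀ {x p q} → x ∼ p → x ∼ q → p ≡ q
  ∼-uniqueℚ x∼p x∼q = Proportional.∼-uniqueˡ ℚ⁺ 1ℚ L v ℚ-torsionFree L-torsionFree v≉ε
    (∼-swap L v ℚ⁺ 1ℚ x∼p) (∼-swap L v ℚ⁺ 1ℚ x∼q)

  ∼-ε : ε ∼ 0ℚ
  ∼-ε = ∼-resp (L.inverseʳ v) ≡.refl (∼-∙ ∼-base (∼-⁻¹ ∼-base))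

  ⊗1-isHomomorphism : IsMagmaHomomorphism L.rawMagma (AbelianGroup.rawMagma M.+ᴹ-abelianGroup) (_⊗ 1ℝ)
  ⊗1-isHomomorphism = record
    { isRelHomomorphism = record { cong = λ x≈y → ⊗-cong x≈y ≈ℝ-refl }
    ; homo = λ x y → ⊗-distribʳ x y 1ℝ
    }

  v⊗-isHomomorphism : IsMagmaHomomorphism (AbelianGroup.rawMagma ℚ⁺)
    (AbelianGroup.rawMagma M.+ᴹ-abelianGroup) (λ q → v ⊗ fromℚ q)
  v⊗-isHomomorphism = record
    { isRelHomomorphism = record { cong = λ { ≡.refl → ≈ᵀ-refl } }
    ; homo = λ p q → ≈ᵀ-trans (⊗-cong L.refl (≈-pointwise λ _ → ≡.refl))
        (⊗-distribˡ v (fromℚ p) (fromℚ q))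
    }

  -- The homomorphisms `_⊗ 1ℝ` and q ↦ v ⊗ q take the same value at `v` and at 1, and their target
  -- is torsion-free.
  ⊗-coordinate : ∀ {x q} → x ∼ q → x ⊗ 1ℝ M.≈ᴹ v ⊗ fromℚ q
  ⊗-coordinate = homomorphisms-agree L ℚ⁺ M.+ᴹ-abelianGroup (RealModule.ℕ-torsionFree (L ⊗ℝ))
    ⊗1-isHomomorphism v⊗-isHomomorphism ≈ᵀ-refl

  ‖v⊗r‖ : ∀ r → ‖ v ⊗ r ‖ ≈ℝ ∣ r ∣ℝ *ℝ ‖ v ‖ᴸ
  ‖v⊗r‖ r = ≈ℝ-trans (‖‖-cong (⊗-cong L.refl (R.sym (R.*-identityʳ r)))) (homogeneous r (v ⊗ 1ℝ))

  ‖‖-coordinate : ∀ {x q} → x ∼ q → ‖ x ‖ᴸ ≈ℝ fromℚ ℚ.∣ q ∣ *ℝ ‖ v ‖ᴸ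
  ‖‖-coordinate {q = q} x∼q = ≈ℝ-trans (‖‖-cong (⊗-coordinate x∼q))
    (≈ℝ-trans (‖v⊗r‖ (fromℚ q)) (R.*-congʳ (≈-pointwise λ _ → ≡.refl)))

  -- A pure tensor `x ⊗ s` is s times x ⊗ 1 = v ⊗ q, and tensors of the form `v ⊗ r` are closed
  -- under the group operations. Hence `‖ v ‖ᴸ` controls the whole semi-norm.
  tensor-is-multiple : ∀ t → ∃[ r ] t M.≈ᴹ v ⊗ r
  tensor-is-multiple (x ⊗ s) = let q , x∼q = coordinate x in
    s *ℝ fromℚ q , ≈ᵀ-trans (⊗-cong L.refl (R.sym (R.*-identityʳ s))) (M.*ₗ-congˡ (⊗-coordinate x∼q))
  tensor-is-multiple 0ᵀ = 0ℝ , ≈ᵀ-trans (≈ᵀ-sym (M.*ₗ-zeroˡ (v ⊗ 0ℝ)))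
    (⊗-cong L.refl (R.zeroˡ 0ℝ))
  tensor-is-multiple (t +ᵀ u) = let r , t≈ = tensor-is-multiple t ; s , u≈ = tensor-is-multiple u in
    r +ℝ s , ≈ᵀ-trans (+ᵀ-cong t≈ u≈) (≈ᵀ-sym (⊗-distribˡ v r s))
  tensor-is-multiple (-ᵀ t) = let r , t≈ = tensor-is-multiple t in
    -ℝ r , ≈ᵀ-trans (-ᵀ-cong t≈) (≈ᵀ-sym (inverseʳ-uniqueᴹ (v ⊗ r) (v ⊗ (-ℝ r))
      (≈ᵀ-trans (≈ᵀ-sym (⊗-distribˡ v r (-ℝ r)))
        (≈ᵀ-trans (⊗-cong L.refl (R.-‿inverseʳ r))
          (≈ᵀ-trans (⊗-cong L.refl (R.sym (R.zeroˡ 0ℝ))) (M.*ₗ-zeroˡ (v ⊗ 0ℝ)))))))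
    where open ModuleProperties (L ⊗ℝ) using (inverseʳ-uniqueᴹ)

  ‖v‖≉0 : NonDegenerate D → ¬ ‖ v ‖ᴸ ≈ℝ 0ℝ
  ‖v‖≉0 nd ‖v‖≈0 = nd λ t → let r , t≈ = tensor-is-multiple t in
    ≈ℝ-trans (‖‖-cong t≈) (≈ℝ-trans (‖v⊗r‖ r) (≈ℝ-trans (R.*-congˡ ‖v‖≈0) (R.zeroʳ ∣ r ∣ℝ)))

-- The isomorphism built from equal sets of norms.

module CommensurableNorms
  (D₁ : ArithmeticDivisor c₁ ℓ₁) (D₂ : ArithmeticDivisor c₂ ℓ₂)
  (nd₁ : NonDegenerate D₁) (nd₂ : NonDegenerate D₂) (S₁≐S₂ : S D₁ ≐ S D₂)
  (r : ℚ)
  (‖v₁‖ : ArithmeticDivisor.‖_‖ᴸ D₁ (Coordinates.v D₁) ≈ℝ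
          fromℚ ℚ.∣ r ∣ *ℝ ArithmeticDivisor.‖_‖ᴸ D₂ (Coordinates.v D₂))
  where
  private
    module D₁ = ArithmeticDivisor D₁
    module D₂ = ArithmeticDivisor D₂
    module L₁ = AbelianGroup D₁.L
    module L₂ = AbelianGroup D₂.L
    module C₁ = Coordinates D₁
    module C₂ = Coordinates D₂
    module R = CommutativeRing ℝ-commutativeRing

    partner₂ : ∀ x → ∃[ y ] D₂.‖ y ‖ᴸ ≈ℝ D₁.‖ x ‖ᴸ
    partner₂ x = proj₁ S₁≐S₂ (x , ≈ℝ-refl)

    partner₁ : ∀ y → ∃[ x ] D₁.‖ x ‖ᴸ ≈ℝ D₂.‖ y ‖ᴸ
    partner₁ y = proj₂ S₁≐S₂ (y , ≈ℝ-refl)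

    -- Norms of both divisors become rational multiples of the one real number `D₂.‖ C₂.v ‖ᴸ`, so
    -- that they can be compared in ℚ.
    ‖‖₁-coordinate : ∀ {x p} → x C₁.∼ p → D₁.‖ x ‖ᴸ ≈ℝ fromℚ ℚ.∣ p ℚ.* r ∣ *ℝ D₂.‖ C₂.v ‖ᴸ
    ‖‖₁-coordinate {x} {p} x∼p = begin
      D₁.‖ x ‖ᴸ                                              ≈⟨ C₁.‖‖-coordinate x∼p ⟩
      fromℚ ℚ.∣ p ∣ *ℝ D₁.‖ C₁.v ‖ᴸ                          ≈⟨ R.*-congˡ ‖v₁‖ ⟩
      fromℚ ℚ.∣ p ∣ *ℝ (fromℚ ℚ.∣ r ∣ *ℝ D₂.‖ C₂.v ‖ᴸ)       ≈⟨ R.*-assoc _ _ _ ⟨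
      fromℚ ℚ.∣ p ∣ *ℝ fromℚ ℚ.∣ r ∣ *ℝ D₂.‖ C₂.v ‖ᴸ         ≈⟨ R.*-congʳ (≈-pointwise λ _ → ℚₚ.∣p*q∣≡∣p∣*∣q∣ p r) ⟨
      fromℚ ℚ.∣ p ℚ.* r ∣ *ℝ D₂.‖ C₂.v ‖ᴸ                    ∎
      where open SetoidReasoning R.setoid

    r≢0 : r ≢ 0ℚ
    r≢0 r≡0 = C₁.‖v‖≉0 nd₁ (≈ℝ-trans ‖v₁‖
      (≈ℝ-trans (R.*-congʳ (≈-pointwise λ _ → cong ℚ.∣_∣ r≡0)) (R.zeroˡ _)))

    *r-injective : ∀ {p q} → p ℚ.* r ≡ q ℚ.* r → p ≡ q
    *r-injective {p} {q} eq = begin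
      p                        ≡⟨ cancel p ⟨
      p ℚ.* r ℚ.* ℚ.1/ r       ≡⟨ cong (ℚ._* ℚ.1/ r) eq ⟩
      q ℚ.* r ℚ.* ℚ.1/ r       ≡⟨ cancel q ⟩
      q                        ∎
      where
      open ≡.≡-Reasoning
      instance
        r-nonZero : ℚ.NonZero r
        r-nonZero = ℚ.≢-nonZero r≢0
      cancel : ∀ p → p ℚ.* r ℚ.* ℚ.1/ r ≡ p
      cancel p = ≡.trans (ℚₚ.*-assoc p r _)
        (≡.trans (cong (p ℚ.*_) (ℚₚ.*-inverseʳ r)) (ℚₚ.*-identityʳ p))

    equal-norms : ∀ {x y p q} → x C₁.∼ p → y C₂.∼ q → D₂.‖ y ‖ᴸ ≈ℝ D₁.‖ x ‖ᴸ →
                  ℚ.∣ q ∣ ≡ ℚ.∣ p ℚ.* r ∣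
    equal-norms x∼p y∼q eq = *ℝ-cancelʳ-fromℚ (C₂.‖v‖≉0 nd₂) _ _
      (≈ℝ-trans (≈ℝ-sym (C₂.‖‖-coordinate y∼q)) (≈ℝ-trans eq (‖‖₁-coordinate x∼p)))

    infix 4 _↦_
    -- The isomorphism is first given as a graph: its values arise from chosen elements of equal
    -- norm and a choice of sign, while the graph depends on coordinates only and is visibly
    -- additive.
    record _↦_ (x : L₁.Carrier) (y : L₂.Carrier) : Set (ℓ₁ ⊔ ℓ₂) where
      constructor graph
      field
        {p} : ℚ
        x∼p : x C₁.∼ p
        y∼pr : y C₂.∼ p ℚ.* r

    ↦-total : ∀ x → ∃[ y ] x ↦ y
    ↦-total x =
      let p , x∼p = C₁.coordinate x
          y , ‖y‖≈‖x‖ = partner₂ x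
          q , y∼q = C₂.coordinate y
      in choose-sign x∼p y∼q (∣∣≡⇒≡∨≡- q (p ℚ.* r) (equal-norms x∼p y∼q ‖y‖≈‖x‖))
      where
      choose-sign : ∀ {p y q} → x C₁.∼ p → y C₂.∼ q →
                    q ≡ p ℚ.* r ⊎ ℚ.- q ≡ p ℚ.* r → ∃[ y′ ] x ↦ y′
      choose-sign x∼p y∼q (inj₁ eq) = _ , graph x∼p (C₂.∼-resp L₂.refl eq y∼q)
      -- The chosen element has coordinate - p r, so its inverse is the image.
      choose-sign x∼p y∼q (inj₂ eq) = _ , graph x∼p (C₂.∼-resp L₂.refl eq (C₂.∼-⁻¹ y∼q))

    ↦-surjective : ∀ y → ∃[ x ] x ↦ y
    ↦-surjective y =
      let q , y∼q = C₂.coordinate y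
          x , ‖x‖≈‖y‖ = partner₁ y
          p , x∼p = C₁.coordinate x
      in choose-sign x∼p y∼q
           (∣∣≡⇒≡∨≡- (p ℚ.* r) q (≡.sym (equal-norms x∼p y∼q (≈ℝ-sym ‖x‖≈‖y‖))))
      where
      choose-sign : ∀ {x p q} → x C₁.∼ p → y C₂.∼ q →
                    p ℚ.* r ≡ q ⊎ ℚ.- (p ℚ.* r) ≡ q → ∃[ x′ ] x′ ↦ y
      choose-sign x∼p y∼q (inj₁ eq) = _ , graph x∼p (C₂.∼-resp L₂.refl (≡.sym eq) y∼q)
      -- Here `y` is given, so the sign is corrected on the side of `x`.
      choose-sign {p = p} x∼p y∼q (inj₂ eq) = _ , graph (C₁.∼-⁻¹ x∼p)
        (C₂.∼-resp L₂.refl (≡.trans (≡.sym eq) (ℚₚ.neg-distribˡ-* p r)) y∼q)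

    ↦-functional : ∀ {x x′ y y′} → x L₁.≈ x′ → x ↦ y → x′ ↦ y′ → y L₂.≈ y′
    ↦-functional x≈x′ (graph x∼p y∼pr) (graph x′∼p′ y′∼p′r) =
      C₂.∼-uniqueᴸ (C₂.∼-resp L₂.refl (cong (ℚ._* r) p≡p′) y∼pr) y′∼p′r
      where p≡p′ = C₁.∼-uniqueℚ (C₁.∼-resp x≈x′ ≡.refl x∼p) x′∼p′

    ↦-injective : ∀ {x x′ y y′} → y L₂.≈ y′ → x ↦ y → x′ ↦ y′ → x L₁.≈ x′
    ↦-injective y≈y′ (graph x∼p y∼pr) (graph x′∼p′ y′∼p′r) =
      C₁.∼-uniqueᴸ (C₁.∼-resp L₁.refl p≡p′ x∼p) x′∼p′
      where p≡p′ = *r-injective (C₂.∼-uniqueℚ (C₂.∼-resp y≈y′ ≡.refl y∼pr) y′∼p′r)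

    ↦-∙ : ∀ {x x′ y y′} → x ↦ y → x′ ↦ y′ → x L₁.∙ x′ ↦ y L₂.∙ y′
    ↦-∙ (graph {p} x∼p y∼pr) (graph {p′} x′∼p′ y′∼p′r) = graph (C₁.∼-∙ x∼p x′∼p′)
      (C₂.∼-resp L₂.refl (≡.sym (ℚₚ.*-distribʳ-+ r p p′)) (C₂.∼-∙ y∼pr y′∼p′r))

    ↦-ε : L₁.ε ↦ L₂.ε
    ↦-ε = graph C₁.∼-ε (C₂.∼-resp L₂.refl (≡.sym (ℚₚ.*-zeroˡ r)) C₂.∼-ε)

    ↦-⁻¹ : ∀ {x y} → x ↦ y → x L₁.⁻¹ ↦ y L₂.⁻¹
    ↦-⁻¹ (graph {p} x∼p y∼pr) = graph (C₁.∼-⁻¹ x∼p)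
      (C₂.∼-resp L₂.refl (ℚₚ.neg-distribˡ-* p r) (C₂.∼-⁻¹ y∼pr))

    ↦-isometric : ∀ {x y} → x ↦ y → D₂.‖ y ‖ᴸ ≈ℝ D₁.‖ x ‖ᴸ
    ↦-isometric (graph x∼p y∼pr) =
      ≈ℝ-trans (C₂.‖‖-coordinate y∼pr) (≈ℝ-sym (‖‖₁-coordinate x∼p))

    -- Each law for `ψ` compares two values at equal arguments, one from `ψ-graph` and one from a
    -- closure property of the graph; `↦-functional` identifies them.
    ↦-isomorphism : (ψ : L₁.Carrier → L₂.Carrier) → (∀ x → x ↦ ψ x) → D₁ ≅ D₂
    ↦-isomorphism ψ ψ-graph = record
      { ψ = ψ
      ; isIsomorphism = record
        { isGroupMonomorphism = record
          { isGroupHomomorphism = record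
            { isMonoidHomomorphism = record
              { isMagmaHomomorphism = record
                { isRelHomomorphism = record
                  { cong = λ {x} {y} x≈y → ↦-functional x≈y (ψ-graph x) (ψ-graph y) }
                ; homo = λ x y →
                    ↦-functional L₁.refl (ψ-graph (x L₁.∙ y)) (↦-∙ (ψ-graph x) (ψ-graph y))
                }
              ; ε-homo = ↦-functional L₁.refl (ψ-graph L₁.ε) ↦-ε
              }
            ; ⁻¹-homo = λ x → ↦-functional L₁.refl (ψ-graph (x L₁.⁻¹)) (↦-⁻¹ (ψ-graph x))
            }
          ; injective = λ {x} {y} ψx≈ψy → ↦-injective ψx≈ψy (ψ-graph x) (ψ-graph y)
          }
        ; surjective = λ y → let x , x↦y = ↦-surjective y in
            x , λ {z} z≈x → ↦-functional z≈x (ψ-graph z) x↦y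
        }
      ; isometric = λ x → ↦-isometric (ψ-graph x)
      }

  isomorphism : D₁ ≅ D₂
  isomorphism = ↦-isomorphism (λ x → proj₁ (↦-total x)) (λ x → proj₂ (↦-total x))

-- The two implications.

S≐⇒≅ : (D₁ : ArithmeticDivisor c₁ ℓ₁) (D₂ : ArithmeticDivisor c₂ ℓ₂) →
  NonDegenerate D₁ → NonDegenerate D₂ → S D₁ ≐ S D₂ → D₁ ≅ D₂
S≐⇒≅ D₁ D₂ nd₁ nd₂ S₁≐S₂ =
  -- An element of L₂ with the norm of the base vector of L₁ makes the ratio of the two base norms
  -- the absolute value of a rational.
  let y₀ , ‖y₀‖≈‖v₁‖ = proj₁ S₁≐S₂ (C₁.v , ≈ℝ-refl)
      r , y₀∼r = C₂.coordinate y₀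
  in CommensurableNorms.isomorphism D₁ D₂ nd₁ nd₂ S₁≐S₂ r
       (≈ℝ-trans (≈ℝ-sym ‖y₀‖≈‖v₁‖) (C₂.‖‖-coordinate y₀∼r))
  where
  module C₁ = Coordinates D₁
  module C₂ = Coordinates D₂

≅⇒S≐ : (D₁ : ArithmeticDivisor c₁ ℓ₁) (D₂ : ArithmeticDivisor c₂ ℓ₂) → D₁ ≅ D₂ → S D₁ ≐ S D₂
≅⇒S≐ D₁ D₂ D₁≅D₂ =
  (λ (x , ‖x‖≈s) → ψ x , ≈ℝ-trans (isometric x) ‖x‖≈s) ,
  -- Surjectivity yields `ψ x` only up to the equality of L₂, so the norm is carried over to `y` by
  -- its congruence.
  (λ (y , ‖y‖≈s) → let x , ψx≈y = surjective y in
    x , ≈ℝ-trans (≈ℝ-sym (isometric x))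
      (≈ℝ-trans (‖‖-cong (⊗-cong (ψx≈y (AbelianGroup.refl (ArithmeticDivisor.L D₁))) ≈ℝ-refl)) ‖y‖≈s))
  where
  open _≅_ D₁≅D₂
  open IsGroupIsomorphism isIsomorphism using (surjective)
  open IsSemiNorm (ArithmeticDivisor.isSemiNorm D₂)

theorem3p11 : ∀ {c₁ ℓ₁ c₂ ℓ₂ : Level} (D₁ : ArithmeticDivisor c₁ ℓ₁) (D₂ : ArithmeticDivisor c₂ ℓ₂) →
    NonDegenerate D₁ → NonDegenerate D₂ → (D₁ ≅ D₂) ⇔ (S D₁ ≐ S D₂)
theorem3p11 D₁ D₂ nd₁ nd₂ = mk⇔ (≅⇒S≐ D₁ D₂) (S≐⇒≅ D₁ D₂ nd₁ nd₂)
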